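{- $\displaystyle \delta(112, 122) = \delta([2,1],[1,2]) = \frac{3}{4}$.
   Context: Patterns are words over a totally ordered alphabet; a word $\sigma$ contains an occurrence of a pattern $\pi$ of length $M$ at a set of $M$ positions if the subsequence of $\sigma$ at those positions is order-isomorphic to $\pi$. $[2,1]$ and $[1,2]$ denote the layered permutations $213$ and $132$ respectively (layered: increasing sequence of decreasing layers, with the given layer lengths). Packing density: for a word $\sigma\in[k]^n$ and a set $\Pi$ of patterns all of length $M$, let $\nu(\Pi,\sigma)$ be the number of length-$M$ position sets of $\sigma$ at which some pattern of $\Pi$ occurs; $\delta(\Pi,k,n)=\max\{\nu(\Pi,\sigma)/\binom{n}{M} : \sigma\in[k]^n\}$; $\delta(\Pi)=\lim_{n\to\infty}\lim_{k\to\infty}\delta(\Pi,k,n)$. Notation $\delta(\pi_1,\dots,\pi_s)$ means $\delta(\{\pi_1,\dots,\pi_s\})$. -}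

module Defs where

open import Data.Nat as ℕ using (ℕ; zero; suc; _⊔_; _≤_)
open import Data.Nat.Combinatorics using (_C_)
open import Data.Integer using (+_)
open import Data.Rational as ℚ using (ℚ; 0ℚ; _/_; ∣_∣; _-_)
open import Data.Fin using (Fin; toℕ) renaming (zero to fzero; suc to fsuc)
open import Data.Vec as Vec using (Vec; []; _∷_; lookup)
open import Data.List as List using (List; []; _∷_; _++_; length; filter; allFin; concatMap; foldr)
open import Data.Bool using (Bool; true; false; _∧_; _∨_)
open import Data.Product using (Σ; ∃; _×_)
open import Relation.Nullary.Decidable using (does)
open import Data.Bool.Properties using (T?)
open import Relation.Binary.PropositionalEquality using (_≡_)

data Cmp : Set where
  LT EQ GT : Cmp

cmp : ℕ → ℕ → Cmp
cmp zero    zero    = EQ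
cmp zero    (suc _) = LT
cmp (suc _) zero    = GT
cmp (suc m) (suc n) = cmp m n

eqCmp : Cmp → Cmp → Bool
eqCmp LT LT = true
eqCmp EQ EQ = true
eqCmp GT GT = true
eqCmp _  _  = false

allB : {A : Set} → (A → Bool) → List A → Bool
allB p = foldr (λ a b → p a ∧ b) true

anyB : {A : Set} → (A → Bool) → List A → Bool
anyB p = foldr (λ a b → p a ∨ b) false

orderIso : {M : ℕ} → Vec ℕ M → Vec ℕ M → Bool
orderIso {M} x y =
  allB (λ a → allB (λ b → eqCmp (cmp (lookup x a) (lookup x b)) (cmp (lookup y a) (lookup y b)))
                   (allFin M))
       (allFin M)

-- all M-element subsets of the positions {0,…,n-1}, each listed once as a strictly increasing tuple
positionSets : (n M : ℕ) → List (Vec (Fin n) M)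
positionSets n       zero    = [] ∷ []
positionSets zero    (suc M) = []
positionSets (suc n) (suc M) =
  List.map (λ v → fzero ∷ Vec.map fsuc v) (positionSets n M)
  ++ List.map (Vec.map fsuc) (positionSets n (suc M))

Word : ℕ → ℕ → Set
Word k n = Vec (Fin k) n

allWords : (k n : ℕ) → List (Word k n)
allWords k zero    = [] ∷ []
allWords k (suc n) = concatMap (λ a → List.map (a ∷_) (allWords k n)) (allFin k)

occursAt : {k n M : ℕ} → Vec ℕ M → Word k n → Vec (Fin n) M → Bool
occursAt π σ ps = orderIso π (Vec.map (λ i → toℕ (lookup σ i)) ps)

ν : {k n M : ℕ} → List (Vec ℕ M) → Word k n → ℕ
ν {n = n} {M = M} Π σ =
  length (filter (λ ps → T? (anyB (λ π → occursAt π σ ps) Π)) (positionSets n M))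

maxν : {M : ℕ} → List (Vec ℕ M) → ℕ → ℕ → ℕ
maxν Π k n = foldr _⊔_ 0 (List.map (ν Π) (allWords k n))

-- a / b as a rational; (convention: 0 when b = 0, only relevant for n < M)
ratio : ℕ → ℕ → ℚ
ratio a zero    = 0ℚ
ratio a (suc b) = (+ a) / suc b

δ : {M : ℕ} → List (Vec ℕ M) → ℕ → ℕ → ℚ
δ {M} Π k n = ratio (maxν Π k n) (n C M)

Converges : (ℕ → ℚ) → ℚ → Set
Converges f L = (ε : ℚ) → 0ℚ ℚ.< ε → ∃ λ N → (m : ℕ) → N ≤ m → ∣ f m - L ∣ ℚ.< ε

-- δ(Π) = lim_{n→∞} lim_{k→∞} δ(Π,k,n) = L
PackingDensity : {M : ℕ} → List (Vec ℕ M) → ℚ → Set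
PackingDensity Π L =
  Σ (ℕ → ℚ) λ d → ((n : ℕ) → Converges (λ k → δ Π k n) (d n)) × Converges d L

p112 p122 p213 p132 : Vec ℕ 3
p112 = 1 ∷ 1 ∷ 2 ∷ []
p122 = 1 ∷ 2 ∷ 2 ∷ []
p213 = 2 ∷ 1 ∷ 3 ∷ []
p132 = 1 ∷ 3 ∷ 2 ∷ []

threeQuarters : ℚ
threeQuarters = (+ 3) / 4

{-# OPTIONS --safe #-}
module Submission where

-- Colour each pair of positions i < j of a word by whether its letters are equal (for 112, 122),
-- respectively form a descent (for 213, 132). Every occurrence of one of the two patterns is then a
-- non-monochromatic triangle, and a non-monochromatic triangle has exactly two "cherries" (vertices
-- whose two edges differ in colour). Counting cherries vertex by vertex (Goodman) gives
-- 2 ν ≤ Σ_v d_v (n − 1 − d_v) ≤ n³/4. Conversely, in a word of two balanced blocks (0…0 1…1,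
-- respectively two decreasing layers) the occurrences are exactly the triples meeting both blocks,
-- so ν/C(n,3) ≥ 3/4. Hence 3/4 ≤ max ν / C(n,3) ≤ (3/4) n³ / (n (n − 1) (n − 2)). Finally ν only
-- depends on the relative order of the letters, so replacing letters by their ranks shows that
-- δ(Π,k,n) is constant in k ≥ n + 1.

open import Defs

open import Algebra.Properties.CommutativeSemigroup using (interchange)
open import Data.Bool.Base using (Bool; true; false; not; _∧_; _∨_; _xor_; T; if_then_else_)
open import Data.Bool.Properties using (T?; T-∧)
open import Data.Empty using (⊥-elim)
open import Data.Fin.Base as Fin using (Fin; toℕ)
open import Data.Fin.Patterns using (0F; 1F; 2F)
open import Data.Fin.Properties using (toℕ-inject≤)
open import Data.Integer.Base as ℤ using (+[1+_]; -[1+_])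
open import Data.Integer.Properties using (+◃n≡+n; ⊖-≥)
open import Data.List.Base as List using (List; []; _∷_; _++_; length; filter; allFin; foldr)
open import Data.List.Membership.Propositional using (_∈_)
open import Data.List.Membership.Propositional.Properties using (∈-map⁺; ∈-concatMap⁺; ∈-allFin)
open import Data.List.Relation.Unary.Any as Any using (here; there)
open import Data.Nat.Base
open import Data.Nat.Combinatorics using (_C_; nCk+nC[k+1]≡[n+1]C[k+1]; nC1≡n)
open import Data.Nat.Coprimality using (Coprime)
open import Data.Nat.Properties
open import Data.Nat.Tactic.RingSolver using (solve-∀)
open import Data.Product.Base using (_×_; _,_; proj₁; proj₂; ∃-syntax)
open import Data.Rational.Base as ℚ using (ℚ; mkℚ)
open import Data.Rational.Properties using (+-inverseʳ; toℚᵘ-cancel-<; toℚᵘ-homo-∣-∣; toℚᵘ-homo-+; toℚᵘ-homo‿-; toℚᵘ-fromℚᵘ)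
open import Data.Rational.Unnormalised.Base as ℚᵘ using (mkℚᵘ; *<*)
import Data.Rational.Unnormalised.Properties as ℚᵘP
import Data.Sign.Base as Sign
open import Data.Sum.Base using (_⊎_; inj₁; inj₂)
open import Data.Unit.Base using (tt)
open import Data.Vec.Base as Vec using (Vec; []; _∷_; lookup)
open import Data.Vec.Properties using (map-∘; map-cong)
open import Function.Base using (_∘_)
open import Function.Bundles using (Equivalence)
open import Relation.Binary.Definitions using (tri<; tri≈; tri>)
open import Relation.Binary.PropositionalEquality
open import Relation.Nullary.Decidable.Core using (yes; no)

-- Finite sums over ℕ

𝟙 : Bool → ℕ
𝟙 true  = 1
𝟙 false = 0

𝟙≤1 : ∀ b → 𝟙 b ≤ 1
𝟙≤1 true  = ≤-refl
𝟙≤1 false = z≤n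

<ᵇ-true : ∀ {i j} → i < j → (i <ᵇ j) ≡ true
<ᵇ-true {zero}  {suc j} _       = refl
<ᵇ-true {suc i} {suc j} (s≤s p) = <ᵇ-true p

<ᵇ-false : ∀ {i j} → j ≤ i → (i <ᵇ j) ≡ false
<ᵇ-false {i}     {zero}  _       = refl
<ᵇ-false {suc i} {suc j} (s≤s p) = <ᵇ-false p

∑ : ℕ → (ℕ → ℕ) → ℕ
∑ zero    f = 0
∑ (suc n) f = ∑ n f + f n

infixl 10 ∑
syntax ∑ n (λ i → t) = ∑[ i < n ] t

∑-cong : ∀ n {f g : ℕ → ℕ} → (∀ i → i < n → f i ≡ g i) → ∑ n f ≡ ∑ n g
∑-cong zero    h = refl
∑-cong (suc n) h = cong₂ _+_ (∑-cong n (λ i i<n → h i (m<n⇒m<1+n i<n))) (h n ≤-refl)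

∑-mono-≤ : ∀ n {f g : ℕ → ℕ} → (∀ i → i < n → f i ≤ g i) → ∑ n f ≤ ∑ n g
∑-mono-≤ zero    h = z≤n
∑-mono-≤ (suc n) h = +-mono-≤ (∑-mono-≤ n (λ i i<n → h i (m<n⇒m<1+n i<n))) (h n ≤-refl)

∑-mono-< : ∀ n {f g : ℕ → ℕ} → (∀ i → i < n → f i ≤ g i) → ∀ j → j < n → f j < g j → ∑ n f < ∑ n g
∑-mono-< (suc n) h j j<1+n fj<gj with m≤n⇒m<n∨m≡n (s≤s⁻¹ j<1+n)
... | inj₁ j<n  = +-mono-<-≤ (∑-mono-< n (λ i i<n → h i (m<n⇒m<1+n i<n)) j j<n fj<gj) (h n ≤-refl)
... | inj₂ refl = +-mono-≤-< (∑-mono-≤ n (λ i i<n → h i (m<n⇒m<1+n i<n))) fj<gj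

∑-const : ∀ n k → ∑[ i < n ] k ≡ n * k
∑-const zero    k = refl
∑-const (suc n) k = trans (cong (_+ k) (∑-const n k)) (+-comm (n * k) k)

∑-zero : ∀ n {f : ℕ → ℕ} → (∀ i → i < n → f i ≡ 0) → ∑ n f ≡ 0
∑-zero n h = trans (∑-cong n h) (trans (∑-const n 0) (*-zeroʳ n))

∑-ones : ∀ n → ∑[ i < n ] 1 ≡ n
∑-ones n = trans (∑-const n 1) (*-identityʳ n)

∑-≤-* : ∀ n {f : ℕ → ℕ} b → (∀ i → i < n → f i ≤ b) → ∑ n f ≤ n * b
∑-≤-* n b h = ≤-trans (∑-mono-≤ n h) (≤-reflexive (∑-const n b))

∑-distrib-+ : ∀ n (f g : ℕ → ℕ) → ∑[ i < n ] (f i + g i) ≡ ∑ n f + ∑ n g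
∑-distrib-+ zero    f g = refl
∑-distrib-+ (suc n) f g = begin
  ∑[ i < n ] (f i + g i) + (f n + g n) ≡⟨ cong (_+ (f n + g n)) (∑-distrib-+ n f g) ⟩
  ∑ n f + ∑ n g + (f n + g n)          ≡⟨ interchange +-commutativeSemigroup (∑ n f) (∑ n g) (f n) (g n) ⟩
  ∑ n f + f n + (∑ n g + g n)          ∎
  where open ≡-Reasoning

*-distribˡ-∑ : ∀ n k (f : ℕ → ℕ) → k * ∑ n f ≡ ∑[ i < n ] (k * f i)
*-distribˡ-∑ zero    k f = *-zeroʳ k
*-distribˡ-∑ (suc n) k f = trans (*-distribˡ-+ k (∑ n f) (f n)) (cong (_+ k * f n) (*-distribˡ-∑ n k f))

*-distribʳ-∑ : ∀ n k (f : ℕ → ℕ) → ∑ n f * k ≡ ∑[ i < n ] (f i * k)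
*-distribʳ-∑ n k f = trans (*-comm (∑ n f) k) (trans (*-distribˡ-∑ n k f) (∑-cong n (λ i _ → *-comm k (f i))))

∑-head : ∀ n (f : ℕ → ℕ) → ∑ (suc n) f ≡ f 0 + ∑[ i < n ] f (suc i)
∑-head zero    f = +-comm 0 (f 0)
∑-head (suc n) f = trans (cong (_+ f (suc n)) (∑-head n f)) (+-assoc (f 0) _ _)

∑-split : ∀ m t (f : ℕ → ℕ) → ∑ (m + t) f ≡ ∑ m f + ∑[ i < t ] f (m + i)
∑-split m zero    f = trans (cong (λ k → ∑ k f) (+-identityʳ m)) (sym (+-identityʳ _))
∑-split m (suc t) f = begin
  ∑ (m + suc t) f                                ≡⟨ cong (λ k → ∑ k f) (+-suc m t) ⟩
  ∑ (m + t) f + f (m + t)                        ≡⟨ cong (_+ f (m + t)) (∑-split m t f) ⟩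
  ∑ m f + ∑[ i < t ] f (m + i) + f (m + t)       ≡⟨ +-assoc (∑ m f) _ _ ⟩
  ∑ m f + (∑[ i < t ] f (m + i) + f (m + t))     ∎
  where open ≡-Reasoning

∑-above : ∀ n v → v < n → ∑[ u < n ] 𝟙 (v <ᵇ u) + suc v ≡ n
∑-above (suc n) v v<1+n with m≤n⇒m<n∨m≡n (s≤s⁻¹ v<1+n)
... | inj₁ v<n = begin
  ∑[ u < n ] 𝟙 (v <ᵇ u) + 𝟙 (v <ᵇ n) + suc v ≡⟨ cong (λ b → ∑[ u < n ] 𝟙 (v <ᵇ u) + 𝟙 b + suc v) (<ᵇ-true v<n) ⟩
  ∑[ u < n ] 𝟙 (v <ᵇ u) + 1 + suc v         ≡⟨ +-assoc (∑[ u < n ] 𝟙 (v <ᵇ u)) 1 (suc v) ⟩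
  ∑[ u < n ] 𝟙 (v <ᵇ u) + suc (suc v)       ≡⟨ +-suc (∑[ u < n ] 𝟙 (v <ᵇ u)) (suc v) ⟩
  suc (∑[ u < n ] 𝟙 (v <ᵇ u) + suc v)       ≡⟨ cong suc (∑-above n v v<n) ⟩
  suc n                                     ∎
  where open ≡-Reasoning
... | inj₂ refl = cong₂ (λ x b → x + 𝟙 b + suc v) (∑-zero v (λ u u<v → cong 𝟙 (<ᵇ-false (<⇒≤ u<v)))) (<ᵇ-false {v} ≤-refl)

below+above : ∀ n v → v < n → v + ∑[ u < n ] 𝟙 (v <ᵇ u) ≡ pred n
below+above n v v<n = cong pred (begin
  suc (v + ∑[ u < n ] 𝟙 (v <ᵇ u)) ≡⟨ cong suc (+-comm v _) ⟩
  suc (∑[ u < n ] 𝟙 (v <ᵇ u) + v) ≡⟨ sym (+-suc _ v) ⟩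
  ∑[ u < n ] 𝟙 (v <ᵇ u) + suc v   ≡⟨ ∑-above n v v<n ⟩
  n                               ∎)
  where open ≡-Reasoning

∑₂ : ℕ → (ℕ → ℕ → ℕ) → ℕ
∑₂ n h = ∑[ l < n ] ∑[ j < l ] h j l

∑₃ : ℕ → (ℕ → ℕ → ℕ → ℕ) → ℕ
∑₃ n g = ∑[ l < n ] ∑[ j < l ] ∑[ i < j ] g i j l

∑₂-head : ∀ n (h : ℕ → ℕ → ℕ) → ∑₂ (suc n) h ≡ ∑[ l < n ] h 0 (suc l) + ∑₂ n (λ j l → h (suc j) (suc l))
∑₂-head n h = begin
  ∑₂ (suc n) h                                                    ≡⟨ ∑-head n _ ⟩
  ∑[ l < n ] ∑ (suc l) (λ j → h j (suc l))                         ≡⟨ ∑-cong n (λ l _ → ∑-head l _) ⟩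
  ∑[ l < n ] (h 0 (suc l) + ∑[ j < l ] h (suc j) (suc l))          ≡⟨ ∑-distrib-+ n _ _ ⟩
  ∑[ l < n ] h 0 (suc l) + ∑₂ n (λ j l → h (suc j) (suc l))         ∎
  where open ≡-Reasoning

∑₃-head : ∀ n (g : ℕ → ℕ → ℕ → ℕ) →
  ∑₃ (suc n) g ≡ ∑₂ n (λ j l → g 0 (suc j) (suc l)) + ∑₃ n (λ i j l → g (suc i) (suc j) (suc l))
∑₃-head n g = begin
  ∑₃ (suc n) g                                                                          ≡⟨ ∑-head n _ ⟩
  ∑[ l < n ] ∑ (suc l) (λ j → ∑[ i < j ] g i j (suc l))                                  ≡⟨ ∑-cong n (λ l _ → ∑-head l _) ⟩
  ∑[ l < n ] ∑[ j < l ] ∑ (suc j) (λ i → g i (suc j) (suc l))                            ≡⟨ ∑-cong n (λ l _ → ∑-cong l (λ j _ → ∑-head j _)) ⟩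
  ∑[ l < n ] ∑[ j < l ] (g 0 (suc j) (suc l) + ∑[ i < j ] g (suc i) (suc j) (suc l))     ≡⟨ ∑-cong n (λ l _ → ∑-distrib-+ l _ _) ⟩
  ∑[ l < n ] (∑[ j < l ] g 0 (suc j) (suc l) + ∑[ j < l ] ∑[ i < j ] g (suc i) (suc j) (suc l)) ≡⟨ ∑-distrib-+ n _ _ ⟩
  ∑₂ n (λ j l → g 0 (suc j) (suc l)) + ∑₃ n (λ i j l → g (suc i) (suc j) (suc l))        ∎
  where open ≡-Reasoning

∑₃-cong : ∀ n {g g′ : ℕ → ℕ → ℕ → ℕ} → (∀ i j l → i < j → j < l → l < n → g i j l ≡ g′ i j l) → ∑₃ n g ≡ ∑₃ n g′
∑₃-cong n h = ∑-cong n (λ l l<n → ∑-cong l (λ j j<l → ∑-cong j (λ i i<j → h i j l i<j j<l l<n)))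

∑₃-mono-≤ : ∀ n {g g′ : ℕ → ℕ → ℕ → ℕ} → (∀ i j l → g i j l ≤ g′ i j l) → ∑₃ n g ≤ ∑₃ n g′
∑₃-mono-≤ n h = ∑-mono-≤ n (λ l _ → ∑-mono-≤ l (λ j _ → ∑-mono-≤ j (λ i _ → h i j l)))

*-distribˡ-∑₃ : ∀ n k (g : ℕ → ℕ → ℕ → ℕ) → k * ∑₃ n g ≡ ∑₃ n (λ i j l → k * g i j l)
*-distribˡ-∑₃ n k g =
  trans (*-distribˡ-∑ n k _) (∑-cong n (λ l _ → trans (*-distribˡ-∑ l k _) (∑-cong l (λ j _ → *-distribˡ-∑ j k _))))

∑₂≡∑∑ : ∀ n (h : ℕ → ℕ → ℕ) → ∑₂ n h ≡ ∑[ i < n ] ∑[ j < n ] (𝟙 (i <ᵇ j) * h i j)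
∑₂≡∑∑ zero    h = refl
∑₂≡∑∑ (suc n) h = begin
  ∑₂ n h + ∑[ i < n ] h i n
    ≡⟨ cong₂ _+_ (∑₂≡∑∑ n h) (∑-cong n (λ i i<n → sym (last-column i i<n))) ⟩
  ∑[ i < n ] ∑[ j < n ] (𝟙 (i <ᵇ j) * h i j) + ∑[ i < n ] (𝟙 (i <ᵇ n) * h i n)
    ≡⟨ sym (∑-distrib-+ n _ _) ⟩
  ∑[ i < n ] ∑[ j < suc n ] (𝟙 (i <ᵇ j) * h i j)
    ≡⟨ sym (+-identityʳ _) ⟩
  ∑[ i < n ] ∑[ j < suc n ] (𝟙 (i <ᵇ j) * h i j) + 0
    ≡⟨ cong₂ _+_ refl (sym last-row) ⟩
  ∑[ i < suc n ] ∑[ j < suc n ] (𝟙 (i <ᵇ j) * h i j) ∎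
  where
  open ≡-Reasoning
  last-column : ∀ i → i < n → 𝟙 (i <ᵇ n) * h i n ≡ h i n
  last-column i i<n = trans (cong (λ b → 𝟙 b * h i n) (<ᵇ-true i<n)) (+-identityʳ _)
  last-row : ∑[ j < suc n ] (𝟙 (n <ᵇ j) * h n j) ≡ 0
  last-row = ∑-zero (suc n) (λ j j<1+n → cong (λ b → 𝟙 b * h n j) (<ᵇ-false (s≤s⁻¹ j<1+n)))

∑₂-distrib-+ : ∀ n (f g : ℕ → ℕ → ℕ) → ∑₂ n (λ j l → f j l + g j l) ≡ ∑₂ n f + ∑₂ n g
∑₂-distrib-+ n f g = trans (∑-cong n (λ l _ → ∑-distrib-+ l _ _)) (∑-distrib-+ n _ _)

-- Goodman's count of cherries

am-gm-≤ : ∀ {a b} → a ≤ b → 4 * (a * b) ≤ (a + b) * (a + b)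
am-gm-≤ {a} {b} a≤b =
  subst (λ b → 4 * (a * b) ≤ (a + b) * (a + b)) (m+[n∸m]≡n a≤b)
        (subst (4 * (a * (a + (b ∸ a))) ≤_) (square a (b ∸ a)) (m≤m+n _ _))
  where
  square : ∀ a d → 4 * (a * (a + d)) + d * d ≡ (a + (a + d)) * (a + (a + d))
  square = solve-∀

am-gm : ∀ a b → 4 * (a * b) ≤ (a + b) * (a + b)
am-gm a b with ≤-total a b
... | inj₁ a≤b = am-gm-≤ a≤b
... | inj₂ b≤a = subst₂ _≤_ (cong (4 *_) (*-comm b a)) (cong₂ _*_ (+-comm b a) (+-comm b a)) (am-gm-≤ b≤a)

-- The number of vertices of a triangle with edge colours x, y, z at which the two incident edges
-- differ in colour: 0 for a monochromatic triangle and 2 otherwise.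
cherries : Bool → Bool → Bool → ℕ
cherries x y z = 𝟙 (x xor y) + 𝟙 (x xor z) + 𝟙 (y xor z)

grow-product : ∀ (f : Bool → ℕ) e → (f false + 𝟙 (e xor false)) * (f true + 𝟙 (e xor true)) ≡ f false * f true + f e
grow-product f true  = lemma (f false) (f true)
  where
  lemma : ∀ a b → (a + 1) * (b + 0) ≡ a * b + b
  lemma = solve-∀
grow-product f false = lemma (f false) (f true)
  where
  lemma : ∀ a b → (a + 0) * (b + 1) ≡ a * b + a
  lemma = solve-∀

𝟙-xor-false+true : ∀ x → 𝟙 (x xor false) + 𝟙 (x xor true) ≡ 1
𝟙-xor-false+true true  = refl
𝟙-xor-false+true false = refl

∑₂-xor≡* : ∀ n (c : ℕ → Bool) → ∑₂ n (λ i j → 𝟙 (c i xor c j)) ≡ ∑[ i < n ] 𝟙 (c i xor false) * ∑[ i < n ] 𝟙 (c i xor true)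
∑₂-xor≡* zero    c = refl
∑₂-xor≡* (suc n) c = begin
  ∑₂ n (λ i j → 𝟙 (c i xor c j)) + ∑[ i < n ] 𝟙 (c i xor c n) ≡⟨ cong (_+ ∑[ i < n ] 𝟙 (c i xor c n)) (∑₂-xor≡* n c) ⟩
  unlike false * unlike true + unlike (c n)                    ≡⟨ sym (grow-product unlike (c n)) ⟩
  (unlike false + 𝟙 (c n xor false)) * (unlike true + 𝟙 (c n xor true)) ∎
  where
  open ≡-Reasoning
  unlike : Bool → ℕ
  unlike b = ∑[ i < n ] 𝟙 (c i xor b)

-- E u v, for u < v, is the colour of the edge uv of a complete graph on ℕ.
module Goodman (E : ℕ → ℕ → Bool) where

  cherriesAt : ℕ → ℕ → ℕ → ℕ
  cherriesAt i j l = cherries (E i j) (E i l) (E j l)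

  -- deg b n v counts the vertices u < n, u ≢ v, whose edge to v is not coloured b.
  deg : Bool → ℕ → ℕ → ℕ
  deg b n v = ∑[ u < v ] 𝟙 (E u v xor b) + ∑[ u < n ] (𝟙 (v <ᵇ u) * 𝟙 (E v u xor b))

  deg-suc : ∀ b n v → v < n → deg b (suc n) v ≡ deg b n v + 𝟙 (E v n xor b)
  deg-suc b n v v<n = begin
    ∑[ u < v ] 𝟙 (E u v xor b) + (∑[ u < n ] (𝟙 (v <ᵇ u) * 𝟙 (E v u xor b)) + 𝟙 (v <ᵇ n) * 𝟙 (E v n xor b))
      ≡⟨ cong (λ x → ∑[ u < v ] 𝟙 (E u v xor b) + (∑[ u < n ] (𝟙 (v <ᵇ u) * 𝟙 (E v u xor b)) + 𝟙 x * 𝟙 (E v n xor b))) (<ᵇ-true v<n) ⟩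
    ∑[ u < v ] 𝟙 (E u v xor b) + (∑[ u < n ] (𝟙 (v <ᵇ u) * 𝟙 (E v u xor b)) + 1 * 𝟙 (E v n xor b))
      ≡⟨ sym (+-assoc (∑[ u < v ] 𝟙 (E u v xor b)) _ _) ⟩
    deg b n v + 1 * 𝟙 (E v n xor b)
      ≡⟨ cong (deg b n v +_) (*-identityˡ _) ⟩
    deg b n v + 𝟙 (E v n xor b) ∎
    where open ≡-Reasoning

  deg-last : ∀ b n → deg b (suc n) n ≡ ∑[ u < n ] 𝟙 (E u n xor b)
  deg-last b n = trans (cong (∑[ u < n ] 𝟙 (E u n xor b) +_) (∑-zero (suc n) later)) (+-identityʳ _)
    where
    later : ∀ u → u < suc n → 𝟙 (n <ᵇ u) * 𝟙 (E n u xor b) ≡ 0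
    later u u<1+n = cong (λ x → 𝟙 x * 𝟙 (E n u xor b)) (<ᵇ-false (s≤s⁻¹ u<1+n))

  deg-false+true : ∀ n v → v < n → deg false n v + deg true n v ≤ n
  deg-false+true n v v<n = begin
    deg false n v + deg true n v
      ≡⟨ interchange +-commutativeSemigroup (∑[ u < v ] 𝟙 (E u v xor false)) _ _ _ ⟩
    (∑[ u < v ] 𝟙 (E u v xor false) + ∑[ u < v ] 𝟙 (E u v xor true))
      + (∑[ u < n ] (𝟙 (v <ᵇ u) * 𝟙 (E v u xor false)) + ∑[ u < n ] (𝟙 (v <ᵇ u) * 𝟙 (E v u xor true)))
      ≡⟨ cong₂ _+_ earlier later ⟩
    v + ∑[ u < n ] 𝟙 (v <ᵇ u)
      ≡⟨ below+above n v v<n ⟩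
    pred n
      ≤⟨ pred[n]≤n ⟩
    n ∎
    where
    open ≤-Reasoning
    earlier : ∑[ u < v ] 𝟙 (E u v xor false) + ∑[ u < v ] 𝟙 (E u v xor true) ≡ v
    earlier = trans (sym (∑-distrib-+ v _ _)) (trans (∑-cong v (λ u _ → 𝟙-xor-false+true (E u v))) (∑-ones v))
    later : ∑[ u < n ] (𝟙 (v <ᵇ u) * 𝟙 (E v u xor false)) + ∑[ u < n ] (𝟙 (v <ᵇ u) * 𝟙 (E v u xor true))
          ≡ ∑[ u < n ] 𝟙 (v <ᵇ u)
    later = trans (sym (∑-distrib-+ n _ _)) (∑-cong n (λ u _ →
      trans (sym (*-distribˡ-+ (𝟙 (v <ᵇ u)) _ _)) (trans (cong (𝟙 (v <ᵇ u) *_) (𝟙-xor-false+true (E v u))) (*-identityʳ _))))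

  degProduct : ℕ → ℕ → ℕ
  degProduct n v = deg false n v * deg true n v

  degProduct-suc : ∀ n v → v < n → degProduct (suc n) v ≡ degProduct n v + deg (E v n) n v
  degProduct-suc n v v<n = begin
    deg false (suc n) v * deg true (suc n) v
      ≡⟨ cong₂ _*_ (deg-suc false n v v<n) (deg-suc true n v v<n) ⟩
    (deg false n v + 𝟙 (E v n xor false)) * (deg true n v + 𝟙 (E v n xor true))
      ≡⟨ grow-product (λ b → deg b n v) (E v n) ⟩
    degProduct n v + deg (E v n) n v ∎
    where open ≡-Reasoning

  new-cherries : ∀ n → ∑₂ n (λ i j → cherriesAt i j n) ≡ ∑[ v < n ] deg (E v n) n v + degProduct (suc n) n
  new-cherries n = begin
    ∑₂ n (λ i j → cherriesAt i j n)
      ≡⟨ trans (∑₂-distrib-+ n _ _) (cong (_+ ∑₂ n (λ i j → 𝟙 (E i n xor E j n))) (∑₂-distrib-+ n _ _)) ⟩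
    ∑₂ n (λ i j → 𝟙 (E i j xor E i n)) + ∑₂ n (λ i j → 𝟙 (E i j xor E j n)) + ∑₂ n (λ i j → 𝟙 (E i n xor E j n))
      ≡⟨ cong₂ _+_ (cong (_+ ∑₂ n (λ i j → 𝟙 (E i j xor E j n))) (∑₂≡∑∑ n _)) (∑₂-xor≡* n (λ i → E i n)) ⟩
    ∑[ v < n ] ∑[ u < n ] (𝟙 (v <ᵇ u) * 𝟙 (E v u xor E v n)) + ∑₂ n (λ u v → 𝟙 (E u v xor E v n))
      + ∑[ i < n ] 𝟙 (E i n xor false) * ∑[ i < n ] 𝟙 (E i n xor true)
      ≡⟨ cong (_+ ∑[ i < n ] 𝟙 (E i n xor false) * ∑[ i < n ] 𝟙 (E i n xor true)) (+-comm _ (∑₂ n (λ u v → 𝟙 (E u v xor E v n)))) ⟩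
    ∑₂ n (λ u v → 𝟙 (E u v xor E v n)) + ∑[ v < n ] ∑[ u < n ] (𝟙 (v <ᵇ u) * 𝟙 (E v u xor E v n))
      + ∑[ i < n ] 𝟙 (E i n xor false) * ∑[ i < n ] 𝟙 (E i n xor true)
      ≡⟨ cong₂ _+_ (sym (∑-distrib-+ n _ _)) (sym (cong₂ _*_ (deg-last false n) (deg-last true n))) ⟩
    ∑[ v < n ] deg (E v n) n v + degProduct (suc n) n ∎
    where open ≡-Reasoning

  goodman : ∀ n → ∑₃ n cherriesAt ≡ ∑[ v < n ] degProduct n v
  goodman zero    = refl
  goodman (suc n) = begin
    ∑₃ n cherriesAt + ∑₂ n (λ i j → cherriesAt i j n)
      ≡⟨ cong₂ _+_ (goodman n) (new-cherries n) ⟩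
    ∑[ v < n ] degProduct n v + (∑[ v < n ] deg (E v n) n v + degProduct (suc n) n)
      ≡⟨ sym (+-assoc (∑[ v < n ] degProduct n v) _ _) ⟩
    ∑[ v < n ] degProduct n v + ∑[ v < n ] deg (E v n) n v + degProduct (suc n) n
      ≡⟨ cong (_+ degProduct (suc n) n) (sym (∑-distrib-+ n _ _)) ⟩
    ∑[ v < n ] (degProduct n v + deg (E v n) n v) + degProduct (suc n) n
      ≡⟨ cong (_+ degProduct (suc n) n) (∑-cong n (λ v v<n → sym (degProduct-suc n v v<n))) ⟩
    ∑[ v < suc n ] degProduct (suc n) v ∎
    where open ≡-Reasoning

  goodman-bound : ∀ n → 4 * ∑[ v < n ] degProduct n v ≤ n * (n * n)
  goodman-bound n = begin
    4 * ∑[ v < n ] degProduct n v    ≡⟨ *-distribˡ-∑ n 4 _ ⟩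
    ∑[ v < n ] (4 * degProduct n v)  ≤⟨ ∑-≤-* n (n * n) pointwise ⟩
    n * (n * n)                      ∎
    where
    open ≤-Reasoning
    pointwise : ∀ v → v < n → 4 * degProduct n v ≤ n * n
    pointwise v v<n = ≤-trans (am-gm (deg false n v) _) (*-mono-≤ (deg-false+true n v v<n) (deg-false+true n v v<n))

-- Occurrences as a triple sum over comparisons

count : {A : Set} → (A → Bool) → List A → ℕ
count p []       = 0
count p (x ∷ xs) = 𝟙 (p x) + count p xs

length-filter≡count : {A : Set} (p : A → Bool) (xs : List A) → length (filter (T? ∘ p) xs) ≡ count p xs
length-filter≡count p []       = refl
length-filter≡count p (x ∷ xs) with p x
... | true  = cong suc (length-filter≡count p xs)
... | false = length-filter≡count p xs

count-++ : {A : Set} (p : A → Bool) (xs ys : List A) → count p (xs ++ ys) ≡ count p xs + count p ys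
count-++ p []       ys = refl
count-++ p (x ∷ xs) ys = trans (cong (𝟙 (p x) +_) (count-++ p xs ys)) (sym (+-assoc (𝟙 (p x)) _ _))

count-map : {A B : Set} (p : B → Bool) (g : A → B) (xs : List A) → count p (List.map g xs) ≡ count (p ∘ g) xs
count-map p g []       = refl
count-map p g (x ∷ xs) = cong (𝟙 (p (g x)) +_) (count-map p g xs)

count-cong : {A : Set} {p q : A → Bool} (xs : List A) → (∀ a → p a ≡ q a) → count p xs ≡ count q xs
count-cong []       h = refl
count-cong (x ∷ xs) h = cong₂ _+_ (cong 𝟙 (h x)) (count-cong xs h)

subseqCount : ∀ {n} M → (Vec ℕ M → Bool) → Vec ℕ n → ℕ
subseqCount zero    f w       = 𝟙 (f [])
subseqCount (suc M) f []      = 0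
subseqCount (suc M) f (x ∷ w) = subseqCount M (f ∘ (x ∷_)) w + subseqCount (suc M) f w

valuesAt : ∀ {k n M} → Word k n → Vec (Fin n) M → Vec ℕ M
valuesAt σ ps = Vec.map (λ i → toℕ (lookup σ i)) ps

count-positionSets : ∀ {k} n M (σ : Word k n) (f : Vec ℕ M → Bool) →
  count (f ∘ valuesAt σ) (positionSets n M) ≡ subseqCount M f (Vec.map toℕ σ)
count-positionSets n       zero    σ       f = +-identityʳ _
count-positionSets zero    (suc M) []      f = refl
count-positionSets (suc n) (suc M) (x ∷ σ) f = begin
  count (f ∘ valuesAt (x ∷ σ)) (List.map withFirst (positionSets n M) ++ List.map withoutFirst (positionSets n (suc M)))
    ≡⟨ count-++ _ (List.map withFirst (positionSets n M)) _ ⟩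
  count (f ∘ valuesAt (x ∷ σ)) (List.map withFirst (positionSets n M)) + count (f ∘ valuesAt (x ∷ σ)) (List.map withoutFirst (positionSets n (suc M)))
    ≡⟨ cong₂ _+_ (count-map _ withFirst (positionSets n M)) (count-map _ withoutFirst (positionSets n (suc M))) ⟩
  count (f ∘ valuesAt (x ∷ σ) ∘ withFirst) (positionSets n M) + count (f ∘ valuesAt (x ∷ σ) ∘ withoutFirst) (positionSets n (suc M))
    ≡⟨ cong₂ _+_ (count-cong (positionSets n M) (λ v → cong (f ∘ (toℕ x ∷_)) (sym (map-∘ _ Fin.suc v))))
                 (count-cong (positionSets n (suc M)) (λ v → cong f (sym (map-∘ _ Fin.suc v)))) ⟩
  count (f ∘ (toℕ x ∷_) ∘ valuesAt σ) (positionSets n M) + count (f ∘ valuesAt σ) (positionSets n (suc M))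
    ≡⟨ cong₂ _+_ (count-positionSets n M σ (f ∘ (toℕ x ∷_))) (count-positionSets n (suc M) σ f) ⟩
  subseqCount (suc M) f (Vec.map toℕ (x ∷ σ)) ∎
  where
  open ≡-Reasoning
  withFirst withoutFirst : ∀ {m} → Vec (Fin n) m → Vec (Fin (suc n)) _
  withFirst v = Fin.zero ∷ Vec.map Fin.suc v
  withoutFirst = Vec.map Fin.suc

at : ∀ {n} → Vec ℕ n → ℕ → ℕ
at []      _       = 0
at (x ∷ w) zero    = x
at (x ∷ w) (suc i) = at w i

subseqCount₁ : ∀ {n} (f : Vec ℕ 1 → Bool) (w : Vec ℕ n) → subseqCount 1 f w ≡ ∑[ l < n ] 𝟙 (f (at w l ∷ []))
subseqCount₁         f []      = refl
subseqCount₁ {suc n} f (x ∷ w) = trans (cong (𝟙 (f (x ∷ [])) +_) (subseqCount₁ f w)) (sym (∑-head n _))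

subseqCount₂ : ∀ {n} (f : Vec ℕ 2 → Bool) (w : Vec ℕ n) → subseqCount 2 f w ≡ ∑₂ n (λ j l → 𝟙 (f (at w j ∷ at w l ∷ [])))
subseqCount₂         f []      = refl
subseqCount₂ {suc n} f (x ∷ w) = trans (cong₂ _+_ (subseqCount₁ _ w) (subseqCount₂ f w)) (sym (∑₂-head n _))

subseqCount₃ : ∀ {n} (f : Vec ℕ 3 → Bool) (w : Vec ℕ n) → subseqCount 3 f w ≡ ∑₃ n (λ i j l → 𝟙 (f (at w i ∷ at w j ∷ at w l ∷ [])))
subseqCount₃         f []      = refl
subseqCount₃ {suc n} f (x ∷ w) = trans (cong₂ _+_ (subseqCount₂ _ w) (subseqCount₃ f w)) (sym (∑₃-head n _))

flipCmp : Cmp → Cmp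
flipCmp LT = GT
flipCmp EQ = EQ
flipCmp GT = LT

cmp-refl : ∀ x → cmp x x ≡ EQ
cmp-refl zero    = refl
cmp-refl (suc x) = cmp-refl x

cmp-sym : ∀ x y → cmp y x ≡ flipCmp (cmp x y)
cmp-sym zero    zero    = refl
cmp-sym zero    (suc y) = refl
cmp-sym (suc x) zero    = refl
cmp-sym (suc x) (suc y) = cmp-sym x y

cmp-< : ∀ {x y} → x < y → cmp x y ≡ LT
cmp-< {zero}  {suc y} _       = refl
cmp-< {suc x} {suc y} (s≤s p) = cmp-< p

cmp-> : ∀ {x y} → y < x → cmp x y ≡ GT
cmp-> {x} {y} y<x = trans (cmp-sym y x) (cong flipCmp (cmp-< y<x))

cmpTable : Cmp → Cmp → Cmp → Fin 3 → Fin 3 → Cmp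
cmpTable c₁ c₂ c₃ 0F 0F = EQ
cmpTable c₁ c₂ c₃ 0F 1F = c₁
cmpTable c₁ c₂ c₃ 0F 2F = c₂
cmpTable c₁ c₂ c₃ 1F 0F = flipCmp c₁
cmpTable c₁ c₂ c₃ 1F 1F = EQ
cmpTable c₁ c₂ c₃ 1F 2F = c₃
cmpTable c₁ c₂ c₃ 2F 0F = flipCmp c₂
cmpTable c₁ c₂ c₃ 2F 1F = flipCmp c₃
cmpTable c₁ c₂ c₃ 2F 2F = EQ

occurs : List (Vec ℕ 3) → Vec ℕ 3 → Bool
occurs Π v = anyB (λ π → orderIso π v) Π

occursᶜ : List (Vec ℕ 3) → Cmp → Cmp → Cmp → Bool
occursᶜ Π c₁ c₂ c₃ =
  anyB (λ π → allB (λ a → allB (λ b → eqCmp (cmp (lookup π a) (lookup π b)) (cmpTable c₁ c₂ c₃ a b)) (allFin 3)) (allFin 3)) Π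

anyB-cong : {A : Set} {p q : A → Bool} (xs : List A) → (∀ a → p a ≡ q a) → anyB p xs ≡ anyB q xs
anyB-cong []       h = refl
anyB-cong (x ∷ xs) h = cong₂ _∨_ (h x) (anyB-cong xs h)

occurs-cmp : ∀ Π x y z → occurs Π (x ∷ y ∷ z ∷ []) ≡ occursᶜ Π (cmp x y) (cmp x z) (cmp y z)
occurs-cmp Π x y z = anyB-cong Π orderIso-cmp
  where
  -- Once cmp x x and cmp y x are expressed through cmp x y, both sides are the same conjunction.
  orderIso-cmp : ∀ π → orderIso π (x ∷ y ∷ z ∷ []) ≡ _
  orderIso-cmp π rewrite cmp-refl x | cmp-refl y | cmp-refl z | cmp-sym x y | cmp-sym x z | cmp-sym y z = refl

occurrences : List (Vec ℕ 3) → (ℕ → ℕ) → ℕ → ℕ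
occurrences Π a n = ∑₃ n (λ i j l → 𝟙 (occursᶜ Π (cmp (a i) (a j)) (cmp (a i) (a l)) (cmp (a j) (a l))))

ν≡occurrences : ∀ {k n} Π (σ : Word k n) → ν Π σ ≡ occurrences Π (at (Vec.map toℕ σ)) n
ν≡occurrences {n = n} Π σ = begin
  ν Π σ                                                         ≡⟨ length-filter≡count _ (positionSets n 3) ⟩
  count (occurs Π ∘ valuesAt σ) (positionSets n 3)              ≡⟨ count-positionSets n 3 σ (occurs Π) ⟩
  subseqCount 3 (occurs Π) w                                    ≡⟨ subseqCount₃ _ w ⟩
  ∑₃ n (λ i j l → 𝟙 (occurs Π (at w i ∷ at w j ∷ at w l ∷ [])))
    ≡⟨ ∑₃-cong n (λ i j l _ _ _ → cong 𝟙 (occurs-cmp Π (at w i) (at w j) (at w l))) ⟩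
  occurrences Π (at w) n                                        ∎
  where
  open ≡-Reasoning
  w = Vec.map toℕ σ

cong₃ : ∀ {A B C D : Set} (f : A → B → C → D) {a a′ b b′ c c′} → a ≡ a′ → b ≡ b′ → c ≡ c′ → f a b c ≡ f a′ b′ c′
cong₃ f refl refl refl = refl

occurrences-cong : ∀ Π n (a b : ℕ → ℕ) → (∀ i j → i < j → j < n → cmp (a i) (a j) ≡ cmp (b i) (b j)) →
  occurrences Π a n ≡ occurrences Π b n
occurrences-cong Π n a b h = ∑₃-cong n (λ i j l i<j j<l l<n →
  cong 𝟙 (cong₃ (occursᶜ Π) (h i j i<j (<-trans j<l l<n)) (h i l (<-trans i<j j<l) l<n) (h j l j<l l<n)))

-- The upper bound

Bichromatic : List (Vec ℕ 3) → (Cmp → Bool) → Set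
Bichromatic Π colour = ∀ c₁ c₂ c₃ → 2 * 𝟙 (occursᶜ Π c₁ c₂ c₃) ≤ cherries (colour c₁) (colour c₂) (colour c₃)

allCmp : (Cmp → Bool) → Bool
allCmp p = p LT ∧ p EQ ∧ p GT

allCmp-sound : ∀ p → T (allCmp p) → ∀ c → T (p c)
allCmp-sound p t LT = proj₁ (Equivalence.to (T-∧ {p LT}) t)
allCmp-sound p t EQ = proj₁ (Equivalence.to (T-∧ {p EQ}) (proj₂ (Equivalence.to (T-∧ {p LT}) t)))
allCmp-sound p t GT = proj₂ (Equivalence.to (T-∧ {p EQ}) (proj₂ (Equivalence.to (T-∧ {p LT}) t)))

bichromaticᵇ : List (Vec ℕ 3) → (Cmp → Bool) → Cmp → Cmp → Cmp → Bool
bichromaticᵇ Π colour c₁ c₂ c₃ = 2 * 𝟙 (occursᶜ Π c₁ c₂ c₃) ≤ᵇ cherries (colour c₁) (colour c₂) (colour c₃)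

bichromatic-by-evaluation : ∀ Π colour →
  T (allCmp λ c₁ → allCmp λ c₂ → allCmp λ c₃ → bichromaticᵇ Π colour c₁ c₂ c₃) → Bichromatic Π colour
bichromatic-by-evaluation Π colour t c₁ c₂ c₃ = ≤ᵇ⇒≤ _ _
  (allCmp-sound (bichromaticᵇ Π colour c₁ c₂) (allCmp-sound (λ c₂ → allCmp (bichromaticᵇ Π colour c₁ c₂))
    (allCmp-sound (λ c₁ → allCmp λ c₂ → allCmp (bichromaticᵇ Π colour c₁ c₂)) t c₁) c₂) c₃)

8ν≤n³ : ∀ Π colour → Bichromatic Π colour → ∀ {k n} (σ : Word k n) → 8 * ν Π σ ≤ n * (n * n)
8ν≤n³ Π colour bichromatic {n = n} σ = begin
  8 * ν Π σ                                        ≡⟨ cong (8 *_) (ν≡occurrences Π σ) ⟩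
  8 * occurrences Π a n                            ≡⟨ *-assoc 4 2 (occurrences Π a n) ⟩
  4 * (2 * occurrences Π a n)                      ≡⟨ cong (4 *_) (*-distribˡ-∑₃ n 2 _) ⟩
  4 * ∑₃ n (λ i j l → 2 * 𝟙 (occursᶜ Π (cmp (a i) (a j)) (cmp (a i) (a l)) (cmp (a j) (a l))))
                                                   ≤⟨ *-monoʳ-≤ 4 (∑₃-mono-≤ n (λ i j l → bichromatic _ _ _)) ⟩
  4 * ∑₃ n cherriesAt                              ≡⟨ cong (4 *_) (goodman n) ⟩
  4 * ∑[ v < n ] degProduct n v                    ≤⟨ goodman-bound n ⟩
  n * (n * n)                                      ∎
  where
  open ≤-Reasoning
  a = at (Vec.map toℕ σ)
  open Goodman (λ i j → colour (cmp (a i) (a j)))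

maxOf : {A : Set} → (A → ℕ) → List A → ℕ
maxOf h xs = foldr _⊔_ 0 (List.map h xs)

≤-maxOf : {A : Set} (h : A → ℕ) {x : A} {xs : List A} → x ∈ xs → h x ≤ maxOf h xs
≤-maxOf h {xs = y ∷ ys} (here refl) = m≤m⊔n (h y) _
≤-maxOf h {xs = y ∷ ys} (there x∈ys) = ≤-trans (≤-maxOf h x∈ys) (m≤n⊔m (h y) _)

maxOf-lub : {A : Set} (h : A → ℕ) (xs : List A) {b : ℕ} → (∀ a → h a ≤ b) → maxOf h xs ≤ b
maxOf-lub h []       h≤b = z≤n
maxOf-lub h (x ∷ xs) h≤b = ⊔-lub (h≤b x) (maxOf-lub h xs h≤b)

*-distribˡ-maxOf : {A : Set} (c : ℕ) (h : A → ℕ) (xs : List A) → c * maxOf h xs ≡ maxOf (λ a → c * h a) xs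
*-distribˡ-maxOf c h []       = *-zeroʳ c
*-distribˡ-maxOf c h (x ∷ xs) = trans (*-distribˡ-⊔ c (h x) _) (cong (c * h x ⊔_) (*-distribˡ-maxOf c h xs))

∈-allWords : ∀ k n (σ : Word k n) → σ ∈ allWords k n
∈-allWords k zero    []      = here refl
∈-allWords k (suc n) (x ∷ σ) = ∈-concatMap⁺ (λ a → List.map (a ∷_) (allWords k n))
  (Any.map (λ { refl → ∈-map⁺ (x ∷_) (∈-allWords k n σ) }) (∈-allFin x))

ν≤maxν : ∀ {M} (Π : List (Vec ℕ M)) {k n} (σ : Word k n) → ν Π σ ≤ maxν Π k n
ν≤maxν Π {k} {n} σ = ≤-maxOf (ν Π) (∈-allWords k n σ)

8maxν≤n³ : ∀ Π colour → Bichromatic Π colour → ∀ n → 8 * maxν Π (suc n) n ≤ n * (n * n)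
8maxν≤n³ Π colour bichromatic n = subst (_≤ n * (n * n)) (sym (*-distribˡ-maxOf 8 (ν Π) (allWords (suc n) n)))
  (maxOf-lub _ (allWords (suc n) n) (8ν≤n³ Π colour bichromatic))

-- Independence of the alphabet size

clamp : (K x : ℕ) → Fin (suc K)
clamp zero    x       = Fin.zero
clamp (suc K) zero    = Fin.zero
clamp (suc K) (suc x) = Fin.suc (clamp K x)

toℕ-clamp : ∀ K x → x ≤ K → toℕ (clamp K x) ≡ x
toℕ-clamp zero    zero    _       = refl
toℕ-clamp (suc K) zero    _       = refl
toℕ-clamp (suc K) (suc x) (s≤s p) = cong suc (toℕ-clamp K x p)

clampedWord : ∀ K m → (ℕ → ℕ) → Word (suc K) m
clampedWord K zero    a = []
clampedWord K (suc m) a = clamp K (a 0) ∷ clampedWord K m (a ∘ suc)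

at-clampedWord : ∀ K m (a : ℕ → ℕ) i → i < m → a i ≤ K → at (Vec.map toℕ (clampedWord K m a)) i ≡ a i
at-clampedWord K (suc m) a zero    _       a₀≤K = toℕ-clamp K (a 0) a₀≤K
at-clampedWord K (suc m) a (suc i) (s≤s p) aᵢ≤K = at-clampedWord K m (a ∘ suc) i p aᵢ≤K

ν-clampedWord : ∀ (Π : List (Vec ℕ 3)) n (a : ℕ → ℕ) → (∀ i → i < n → a i ≤ n) → ν Π (clampedWord n n a) ≡ occurrences Π a n
ν-clampedWord Π n a bounded = trans (ν≡occurrences Π (clampedWord n n a))
  (occurrences-cong Π n (at (Vec.map toℕ (clampedWord n n a))) a (λ i j i<j j<n → cong₂ cmp (value i (<-trans i<j j<n)) (value j j<n)))
  where
  value : ∀ i → i < n → at (Vec.map toℕ (clampedWord n n a)) i ≡ a i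
  value i i<n = at-clampedWord n n a i i<n (bounded i i<n)

𝟙-<ᵇ-monoʳ : ∀ x {y z} → y ≤ z → 𝟙 (x <ᵇ y) ≤ 𝟙 (x <ᵇ z)
𝟙-<ᵇ-monoʳ x {y} y≤z with x <? y
... | yes x<y = ≤-reflexive (cong 𝟙 (trans (<ᵇ-true x<y) (sym (<ᵇ-true (<-≤-trans x<y y≤z)))))
... | no  x≮y = subst (_≤ _) (sym (cong 𝟙 (<ᵇ-false (≮⇒≥ x≮y)))) z≤n

module _ (a : ℕ → ℕ) (n : ℕ) where

  rank : ℕ → ℕ
  rank i = ∑[ u < n ] 𝟙 (a u <ᵇ a i)

  rank-≤ : ∀ i → rank i ≤ n
  rank-≤ i = subst (rank i ≤_) (*-identityʳ n) (∑-≤-* n 1 (λ u _ → 𝟙≤1 (a u <ᵇ a i)))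

  rank-mono-< : ∀ i j → i < n → a i < a j → rank i < rank j
  rank-mono-< i j i<n aᵢ<aⱼ = ∑-mono-< n (λ u _ → 𝟙-<ᵇ-monoʳ (a u) (<⇒≤ aᵢ<aⱼ)) i i<n
    (subst₂ (λ b b′ → 𝟙 b < 𝟙 b′) (sym (<ᵇ-false {a i} ≤-refl)) (sym (<ᵇ-true aᵢ<aⱼ)) ≤-refl)

  rank-cmp : ∀ i j → i < n → j < n → cmp (rank i) (rank j) ≡ cmp (a i) (a j)
  rank-cmp i j i<n j<n with <-cmp (a i) (a j)
  ... | tri< aᵢ<aⱼ _ _ = trans (cmp-< (rank-mono-< i j i<n aᵢ<aⱼ)) (sym (cmp-< aᵢ<aⱼ))
  ... | tri> _ _ aⱼ<aᵢ = trans (cmp-> (rank-mono-< j i j<n aⱼ<aᵢ)) (sym (cmp-> aⱼ<aᵢ))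
  ... | tri≈ _ aᵢ≡aⱼ _ = begin
    cmp (rank i) (rank j) ≡⟨ cong (λ x → cmp (∑[ u < n ] 𝟙 (a u <ᵇ x)) (rank j)) aᵢ≡aⱼ ⟩
    cmp (rank j) (rank j) ≡⟨ cmp-refl (rank j) ⟩
    EQ                    ≡⟨ sym (cmp-refl (a j)) ⟩
    cmp (a j) (a j)       ≡⟨ cong (λ x → cmp x (a j)) (sym aᵢ≡aⱼ) ⟩
    cmp (a i) (a j)       ∎
    where open ≡-Reasoning

compress : ∀ {k n} → Word k n → Word (suc n) n
compress {n = n} σ = clampedWord n n (rank (at (Vec.map toℕ σ)) n)

ν-compress : ∀ (Π : List (Vec ℕ 3)) {k n} (σ : Word k n) → ν Π σ ≡ ν Π (compress σ)
ν-compress Π {n = n} σ = begin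
  ν Π σ                             ≡⟨ ν≡occurrences Π σ ⟩
  occurrences Π a n                 ≡⟨ occurrences-cong Π n a (rank a n) (λ i j i<j j<n → sym (rank-cmp a n i j (<-trans i<j j<n) j<n)) ⟩
  occurrences Π (rank a n) n        ≡⟨ sym (ν-clampedWord Π n (rank a n) (λ i _ → rank-≤ a n i)) ⟩
  ν Π (compress σ)                  ∎
  where
  open ≡-Reasoning
  a = at (Vec.map toℕ σ)

embed : ∀ {k n} → suc n ≤ k → Word (suc n) n → Word k n
embed k>n = Vec.map (λ x → Fin.inject≤ x k>n)

ν-embed : ∀ (Π : List (Vec ℕ 3)) {k n} (k>n : suc n ≤ k) (τ : Word (suc n) n) → ν Π (embed k>n τ) ≡ ν Π τ
ν-embed Π {n = n} k>n τ = begin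
  ν Π (embed k>n τ)                                    ≡⟨ ν≡occurrences Π (embed k>n τ) ⟩
  occurrences Π (at (Vec.map toℕ (embed k>n τ))) n     ≡⟨ cong (λ w → occurrences Π (at w) n) same-values ⟩
  occurrences Π (at (Vec.map toℕ τ)) n                 ≡⟨ sym (ν≡occurrences Π τ) ⟩
  ν Π τ                                                ∎
  where
  open ≡-Reasoning
  same-values : Vec.map toℕ (embed k>n τ) ≡ Vec.map toℕ τ
  same-values = trans (sym (map-∘ toℕ _ τ)) (map-cong (λ x → toℕ-inject≤ x k>n) τ)

maxν-stable : ∀ (Π : List (Vec ℕ 3)) k n → suc n ≤ k → maxν Π k n ≡ maxν Π (suc n) n
maxν-stable Π k n k>n = ≤-antisym
  (maxOf-lub (ν Π) (allWords k n) (λ σ → subst (_≤ maxν Π (suc n) n) (sym (ν-compress Π σ)) (ν≤maxν Π (compress σ))))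
  (maxOf-lub (ν Π) (allWords (suc n) n) (λ τ → subst (_≤ maxν Π k n) (ν-embed Π k>n τ) (ν≤maxν Π (embed k>n τ))))

-- The lower bound: two-block words

sameBlock : ℕ → ℕ → ℕ → Bool
sameBlock m u v = not ((u <ᵇ m) xor (v <ᵇ m))

blockCmp : Cmp → ℕ → ℕ → ℕ → Cmp
blockCmp c m u v = if sameBlock m u v then c else LT

TwoBlock : Cmp → ℕ → ℕ → (ℕ → ℕ) → Set
TwoBlock c m t a = ∀ i j → i < j → j < m + t → cmp (a i) (a j) ≡ blockCmp c m i j

+-<ᵇ-cancelˡ : ∀ m i j → (m + i <ᵇ m + j) ≡ (i <ᵇ j)
+-<ᵇ-cancelˡ zero    i j = refl
+-<ᵇ-cancelˡ (suc m) i j = +-<ᵇ-cancelˡ m i j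

-- In a two-block word, Π occurs exactly at the triples meeting both blocks.
BlockExact : List (Vec ℕ 3) → Cmp → Set
BlockExact Π c = occursᶜ Π c c c ≡ false × occursᶜ Π c LT LT ≡ true × occursᶜ Π LT LT c ≡ true

module TwoBlocks (m t : ℕ) where

  open Goodman (sameBlock m)

  inner-first : ∀ {u v} → u < m → v < m → sameBlock m u v ≡ true
  inner-first u<m v<m rewrite <ᵇ-true u<m | <ᵇ-true v<m = refl

  inner-second : ∀ {u v} → m ≤ u → m ≤ v → sameBlock m u v ≡ true
  inner-second m≤u m≤v rewrite <ᵇ-false m≤u | <ᵇ-false m≤v = refl

  across : ∀ {u v} → u < m → m ≤ v → sameBlock m u v ≡ false
  across u<m m≤v rewrite <ᵇ-true u<m | <ᵇ-false m≤v = refl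

  deg-first : ∀ b v → v < m → deg b (m + t) v ≡ pred m * 𝟙 (not b) + t * 𝟙 b
  deg-first b v v<m = begin
    ∑[ u < v ] 𝟙 (sameBlock m u v xor b) + ∑[ u < m + t ] (𝟙 (v <ᵇ u) * 𝟙 (sameBlock m v u xor b))
      ≡⟨ cong₂ _+_ (∑-cong v (λ u u<v → cong (λ x → 𝟙 (x xor b)) (inner-first (<-trans u<v v<m) v<m))) (∑-split m t _) ⟩
    ∑[ u < v ] 𝟙 (not b) + (∑[ u < m ] (𝟙 (v <ᵇ u) * 𝟙 (sameBlock m v u xor b)) + ∑[ i < t ] (𝟙 (v <ᵇ m + i) * 𝟙 (sameBlock m v (m + i) xor b)))
      ≡⟨ cong₂ _+_ (∑-const v _) (cong₂ _+_
           (∑-cong m (λ u u<m → cong (λ x → 𝟙 (v <ᵇ u) * 𝟙 (x xor b)) (inner-first v<m u<m)))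
           (∑-cong t (λ i _ → cong₂ (λ x y → 𝟙 x * 𝟙 (y xor b)) (<ᵇ-true (<-≤-trans v<m (m≤m+n m i))) (across v<m (m≤m+n m i))))) ⟩
    v * 𝟙 (not b) + (∑[ u < m ] (𝟙 (v <ᵇ u) * 𝟙 (not b)) + ∑[ i < t ] (1 * 𝟙 b))
      ≡⟨ cong₂ (λ x y → v * 𝟙 (not b) + (x + y)) (sym (*-distribʳ-∑ m (𝟙 (not b)) _)) (trans (∑-const t _) (cong (t *_) (*-identityˡ _))) ⟩
    v * 𝟙 (not b) + (∑[ u < m ] 𝟙 (v <ᵇ u) * 𝟙 (not b) + t * 𝟙 b)
      ≡⟨ sym (+-assoc (v * 𝟙 (not b)) _ _) ⟩
    v * 𝟙 (not b) + ∑[ u < m ] 𝟙 (v <ᵇ u) * 𝟙 (not b) + t * 𝟙 b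
      ≡⟨ cong (_+ t * 𝟙 b) (trans (sym (*-distribʳ-+ (𝟙 (not b)) v _)) (cong (_* 𝟙 (not b)) (below+above m v v<m))) ⟩
    pred m * 𝟙 (not b) + t * 𝟙 b ∎
    where open ≡-Reasoning

  deg-second : ∀ b i → i < t → deg b (m + t) (m + i) ≡ pred t * 𝟙 (not b) + m * 𝟙 b
  deg-second b i i<t = begin
    ∑[ u < m + i ] 𝟙 (sameBlock m u (m + i) xor b) + ∑[ u < m + t ] (𝟙 (m + i <ᵇ u) * 𝟙 (sameBlock m (m + i) u xor b))
      ≡⟨ cong₂ _+_ (∑-split m i _) (∑-split m t _) ⟩
    ∑[ u < m ] 𝟙 (sameBlock m u (m + i) xor b) + ∑[ u < i ] 𝟙 (sameBlock m (m + u) (m + i) xor b)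
      + (∑[ u < m ] (𝟙 (m + i <ᵇ u) * 𝟙 (sameBlock m (m + i) u xor b)) + ∑[ u < t ] (𝟙 (m + i <ᵇ m + u) * 𝟙 (sameBlock m (m + i) (m + u) xor b)))
      ≡⟨ cong₂ _+_
           (cong₂ _+_ (∑-cong m (λ u u<m → cong (λ x → 𝟙 (x xor b)) (across u<m (m≤m+n m i))))
                      (∑-cong i (λ u _ → cong (λ x → 𝟙 (x xor b)) (inner-second (m≤m+n m u) (m≤m+n m i)))))
           (cong₂ _+_ (∑-zero m (λ u u<m → cong (λ x → 𝟙 x * 𝟙 (sameBlock m (m + i) u xor b)) (<ᵇ-false (≤-trans (<⇒≤ u<m) (m≤m+n m i)))))
                      (∑-cong t (λ u _ → cong₂ (λ x y → 𝟙 x * 𝟙 (y xor b)) (+-<ᵇ-cancelˡ m i u) (inner-second (m≤m+n m i) (m≤m+n m u))))) ⟩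
    ∑[ u < m ] 𝟙 b + ∑[ u < i ] 𝟙 (not b) + (0 + ∑[ u < t ] (𝟙 (i <ᵇ u) * 𝟙 (not b)))
      ≡⟨ cong₂ _+_ (cong₂ _+_ (∑-const m _) (∑-const i _)) (sym (*-distribʳ-∑ t (𝟙 (not b)) _)) ⟩
    m * 𝟙 b + i * 𝟙 (not b) + ∑[ u < t ] 𝟙 (i <ᵇ u) * 𝟙 (not b)
      ≡⟨ rearrange (m * 𝟙 b) (i * 𝟙 (not b)) _ ⟩
    (i * 𝟙 (not b) + ∑[ u < t ] 𝟙 (i <ᵇ u) * 𝟙 (not b)) + m * 𝟙 b
      ≡⟨ cong (_+ m * 𝟙 b) (trans (sym (*-distribʳ-+ (𝟙 (not b)) i _)) (cong (_* 𝟙 (not b)) (below+above t i i<t))) ⟩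
    pred t * 𝟙 (not b) + m * 𝟙 b ∎
    where
    open ≡-Reasoning
    rearrange : ∀ x y z → x + y + z ≡ (y + z) + x
    rearrange = solve-∀

  degProduct-from-deg : ∀ n v x y → (∀ b → deg b n v ≡ x * 𝟙 (not b) + y * 𝟙 b) → degProduct n v ≡ x * y
  degProduct-from-deg n v x y deg≡ = trans (cong₂ _*_ (deg≡ false) (deg≡ true)) (product x y)
    where
    product : ∀ x y → (x * 1 + y * 0) * (x * 0 + y * 1) ≡ x * y
    product = solve-∀

  degProduct-first : ∀ v → v < m → degProduct (m + t) v ≡ pred m * t
  degProduct-first v v<m = degProduct-from-deg (m + t) v (pred m) t (λ b → deg-first b v v<m)

  degProduct-second : ∀ i → i < t → degProduct (m + t) (m + i) ≡ pred t * m
  degProduct-second i i<t = degProduct-from-deg (m + t) (m + i) (pred t) m (λ b → deg-second b i i<t)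

  ∑-degProduct : ∑[ v < m + t ] degProduct (m + t) v ≡ m * (pred m * t) + t * (pred t * m)
  ∑-degProduct = begin
    ∑[ v < m + t ] degProduct (m + t) v                                   ≡⟨ ∑-split m t _ ⟩
    ∑[ v < m ] degProduct (m + t) v + ∑[ i < t ] degProduct (m + t) (m + i) ≡⟨ cong₂ _+_ (∑-cong m degProduct-first) (∑-cong t degProduct-second) ⟩
    ∑[ v < m ] (pred m * t) + ∑[ i < t ] (pred t * m)                     ≡⟨ cong₂ _+_ (∑-const m _) (∑-const t _) ⟩
    m * (pred m * t) + t * (pred t * m)                                   ∎
    where open ≡-Reasoning

  block-exact : ∀ Π c → BlockExact Π c → ∀ i j l → i < j → j < l →
    2 * 𝟙 (occursᶜ Π (blockCmp c m i j) (blockCmp c m i l) (blockCmp c m j l)) ≡ cherriesAt i j l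
  block-exact Π c (ccc , abb , bbc) i j l i<j j<l = by-blocks (i <ᵇ m) (j <ᵇ m) (l <ᵇ m) (first-block j<l) (first-block i<j)
    where
    first-block : ∀ {u v} → u < v → T (v <ᵇ m) → T (u <ᵇ m)
    first-block {u} {v} u<v v<m = <⇒<ᵇ (<-trans u<v (<ᵇ⇒< v m v<m))
    by-blocks : ∀ x y z → (T z → T y) → (T y → T x) →
      2 * 𝟙 (occursᶜ Π (if not (x xor y) then c else LT) (if not (x xor z) then c else LT) (if not (y xor z) then c else LT))
        ≡ cherries (not (x xor y)) (not (x xor z)) (not (y xor z))
    by-blocks true  true  true  _ _ = cong (λ b → 2 * 𝟙 b) ccc
    by-blocks true  true  false _ _ = cong (λ b → 2 * 𝟙 b) abb
    by-blocks true  false false _ _ = cong (λ b → 2 * 𝟙 b) bbc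
    by-blocks false false false _ _ = cong (λ b → 2 * 𝟙 b) ccc
    by-blocks true  false true  z⇒y _   = ⊥-elim (z⇒y tt)
    by-blocks false true  _     _   y⇒x = ⊥-elim (y⇒x tt)
    by-blocks false false true  z⇒y _   = ⊥-elim (z⇒y tt)

  occurrences-twoBlock : ∀ Π c → BlockExact Π c → ∀ a → TwoBlock c m t a →
    2 * occurrences Π a (m + t) ≡ m * (pred m * t) + t * (pred t * m)
  occurrences-twoBlock Π c exact a twoBlock = begin
    2 * occurrences Π a (m + t)
      ≡⟨ *-distribˡ-∑₃ (m + t) 2 _ ⟩
    ∑₃ (m + t) (λ i j l → 2 * 𝟙 (occursᶜ Π (cmp (a i) (a j)) (cmp (a i) (a l)) (cmp (a j) (a l))))
      ≡⟨ ∑₃-cong (m + t) (λ i j l i<j j<l l<n → trans (cong₃ (λ x y z → 2 * 𝟙 (occursᶜ Π x y z))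
           (twoBlock i j i<j (<-trans j<l l<n)) (twoBlock i l (<-trans i<j j<l) l<n) (twoBlock j l j<l l<n))
           (block-exact Π c exact i j l i<j j<l)) ⟩
    ∑₃ (m + t) cherriesAt
      ≡⟨ goodman (m + t) ⟩
    ∑[ v < m + t ] degProduct (m + t) v
      ≡⟨ ∑-degProduct ⟩
    m * (pred m * t) + t * (pred t * m) ∎
    where open ≡-Reasoning

twoBlock-lower : ∀ Π c → BlockExact Π c → ∀ m t a → TwoBlock c m t a → (∀ i → i < m + t → a i ≤ m + t) →
  m * (pred m * t) + t * (pred t * m) ≤ 2 * maxν Π (suc (m + t)) (m + t)
twoBlock-lower Π c exact m t a twoBlock bounded = begin
  m * (pred m * t) + t * (pred t * m) ≡⟨ sym (TwoBlocks.occurrences-twoBlock m t Π c exact a twoBlock) ⟩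
  2 * occurrences Π a (m + t)         ≡⟨ cong (2 *_) (sym (ν-clampedWord Π (m + t) a bounded)) ⟩
  2 * ν Π (clampedWord (m + t) (m + t) a) ≤⟨ *-monoʳ-≤ 2 (ν≤maxν Π (clampedWord (m + t) (m + t) a)) ⟩
  2 * maxν Π (suc (m + t)) (m + t)    ∎
  where open ≤-Reasoning

flatWord : ℕ → ℕ → ℕ
flatWord m i = if i <ᵇ m then 0 else 1

flatWord-twoBlock : ∀ m t → TwoBlock EQ m t (flatWord m)
flatWord-twoBlock m t i j i<j _ with i <? m | j <? m
... | yes i<m | yes j<m rewrite <ᵇ-true i<m | <ᵇ-true j<m = refl
... | yes i<m | no  j≮m rewrite <ᵇ-true i<m | <ᵇ-false (≮⇒≥ j≮m) = refl
... | no  i≮m | no  j≮m rewrite <ᵇ-false (≮⇒≥ i≮m) | <ᵇ-false (≮⇒≥ j≮m) = refl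
... | no  i≮m | yes j<m = ⊥-elim (i≮m (<-trans i<j j<m))

flatWord-≤ : ∀ m t i → i < m + t → flatWord m i ≤ m + t
flatWord-≤ m t i i<m+t with i <ᵇ m
... | true  = z≤n
... | false = ≤-trans (s≤s z≤n) i<m+t

layeredWord : ℕ → ℕ → ℕ → ℕ
layeredWord m t i = if i <ᵇ m then m ∸ i else (m + t + m) ∸ i

layeredWord-twoBlock : ∀ m t → TwoBlock GT m t (layeredWord m t)
layeredWord-twoBlock m t i j i<j j<m+t with i <? m | j <? m
... | yes i<m | yes j<m rewrite <ᵇ-true i<m | <ᵇ-true j<m = cmp-> (∸-monoʳ-< i<j (<⇒≤ j<m))
... | yes i<m | no  j≮m rewrite <ᵇ-true i<m | <ᵇ-false (≮⇒≥ j≮m) = cmp-< (≤-<-trans (m∸n≤m m i) first<second)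
  where
  first<second : m < (m + t + m) ∸ j
  first<second = m+n≤o⇒m≤o∸n (suc m) (begin
    suc m + j   ≡⟨ sym (+-suc m j) ⟩
    m + suc j   ≤⟨ +-monoʳ-≤ m j<m+t ⟩
    m + (m + t) ≡⟨ +-comm m (m + t) ⟩
    m + t + m   ∎)
    where open ≤-Reasoning
... | no  i≮m | no  j≮m rewrite <ᵇ-false (≮⇒≥ i≮m) | <ᵇ-false (≮⇒≥ j≮m) = cmp-> (∸-monoʳ-< i<j (≤-trans (<⇒≤ j<m+t) (m≤m+n (m + t) m)))
... | no  i≮m | yes j<m = ⊥-elim (i≮m (<-trans i<j j<m))

layeredWord-≤ : ∀ m t i → i < m + t → layeredWord m t i ≤ m + t
layeredWord-≤ m t i _ with i <? m
... | yes i<m rewrite <ᵇ-true i<m = ≤-trans (m∸n≤m m i) (m≤m+n m t)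
... | no  i≮m rewrite <ᵇ-false (≮⇒≥ i≮m) = subst ((m + t + m) ∸ i ≤_) (m+n∸n≡m (m + t) m) (∸-monoʳ-≤ (m + t + m) (≮⇒≥ i≮m))

balanced : ∀ q → ∃[ m ] ∃[ t ] m + t ≡ q × (t ≡ m ⊎ t ≡ suc m)
balanced zero    = 0 , 0 , refl , inj₁ refl
balanced (suc q) with balanced q
... | m , .m       , m+m≡q , inj₁ refl = m , suc m , trans (+-suc m m) (cong suc m+m≡q) , inj₂ refl
... | m , .(suc m) , m+t≡q , inj₂ refl = suc m , suc m , cong suc m+t≡q , inj₁ refl

2*C2 : ∀ n → 2 * (suc n C 2) ≡ suc n * n
2*C2 zero    = refl
2*C2 (suc n) = begin
  2 * (suc (suc n) C 2)             ≡⟨ cong (2 *_) (sym (nCk+nC[k+1]≡[n+1]C[k+1] (suc n) 1)) ⟩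
  2 * (suc n C 1 + suc n C 2)       ≡⟨ *-distribˡ-+ 2 (suc n C 1) (suc n C 2) ⟩
  2 * (suc n C 1) + 2 * (suc n C 2) ≡⟨ cong₂ (λ x y → 2 * x + y) (nC1≡n (suc n)) (2*C2 n) ⟩
  2 * suc n + suc n * n             ≡⟨ pascal n ⟩
  suc (suc n) * suc n               ∎
  where
  open ≡-Reasoning
  pascal : ∀ n → 2 * (1 + n) + (1 + n) * n ≡ (2 + n) * (1 + n)
  pascal = solve-∀

6*C3 : ∀ n → 6 * (suc (suc n) C 3) ≡ suc (suc n) * suc n * n
6*C3 zero    = refl
6*C3 (suc n) = begin
  6 * ((3 + n) C 3)                   ≡⟨ cong (6 *_) (sym (nCk+nC[k+1]≡[n+1]C[k+1] (2 + n) 2)) ⟩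
  6 * ((2 + n) C 2 + (2 + n) C 3)   ≡⟨ *-distribˡ-+ 6 ((2 + n) C 2) ((2 + n) C 3) ⟩
  6 * ((2 + n) C 2) + 6 * ((2 + n) C 3) ≡⟨ cong₂ _+_ (trans (*-assoc 3 2 ((2 + n) C 2)) (cong (3 *_) (2*C2 (suc n)))) (6*C3 n) ⟩
  3 * ((2 + n) * (1 + n)) + (2 + n) * (1 + n) * n ≡⟨ pascal n ⟩
  (3 + n) * (2 + n) * (1 + n)       ∎
  where
  open ≡-Reasoning
  pascal : ∀ n → 3 * ((2 + n) * (1 + n)) + (2 + n) * (1 + n) * n ≡ (3 + n) * (2 + n) * (1 + n)
  pascal = solve-∀

balanced-bound : ∀ m t → (t ≡ m ⊎ t ≡ suc m) → 6 * ((suc m + suc t) C 3) ≤ 4 * (suc m * (m * suc t) + suc t * (t * suc m))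
balanced-bound m t balance = begin
  6 * ((suc m + suc t) C 3)                 ≡⟨ cong (λ k → 6 * (suc k C 3)) (+-suc m t) ⟩
  6 * ((2 + (m + t)) C 3)                   ≡⟨ 6*C3 (m + t) ⟩
  (2 + (m + t)) * (1 + (m + t)) * (m + t)   ≤⟨ by-balance balance ⟩
  4 * (suc m * (m * suc t) + suc t * (t * suc m)) ∎
  where
  open ≤-Reasoning
  even : ∀ m → 4 * (suc m * (m * suc m) + suc m * (m * suc m)) ≡ (2 + (m + m)) * (1 + (m + m)) * (m + m) + 4 * m * (m + 1)
  even = solve-∀
  odd : ∀ m → 4 * (suc m * (m * suc (suc m)) + suc (suc m) * (suc m * suc m)) ≡ (2 + (m + suc m)) * (1 + (m + suc m)) * (m + suc m) + 2 * (m + 1) * (2 * m + 1)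
  odd = solve-∀
  by-balance : (t ≡ m ⊎ t ≡ suc m) → (2 + (m + t)) * (1 + (m + t)) * (m + t) ≤ 4 * (suc m * (m * suc t) + suc t * (t * suc m))
  by-balance (inj₁ refl) = subst ((2 + (m + m)) * (1 + (m + m)) * (m + m) ≤_) (sym (even m)) (m≤m+n _ _)
  by-balance (inj₂ refl) = subst ((2 + (m + suc m)) * (1 + (m + suc m)) * (m + suc m) ≤_) (sym (odd m)) (m≤m+n _ _)

6C≤8maxν : ∀ Π c → BlockExact Π c → (a : ℕ → ℕ → ℕ → ℕ) → (∀ m t → TwoBlock c m t (a m t)) →
  (∀ m t i → i < m + t → a m t i ≤ m + t) → ∀ s → 6 * ((3 + s) C 3) ≤ 8 * maxν Π (4 + s) (3 + s)
6C≤8maxν Π c exact a twoBlock bounded s with balanced (suc s)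
... | m , t , m+t≡1+s , balance = subst (λ n → 6 * (n C 3) ≤ 8 * maxν Π (suc n) n) (cong suc (trans (+-suc m t) (cong suc m+t≡1+s))) (begin
  6 * ((suc m + suc t) C 3)                       ≤⟨ balanced-bound m t balance ⟩
  4 * (suc m * (m * suc t) + suc t * (t * suc m)) ≤⟨ *-monoʳ-≤ 4 (twoBlock-lower Π c exact (suc m) (suc t) (a (suc m) (suc t)) (twoBlock _ _) (bounded _ _)) ⟩
  4 * (2 * maxν Π (suc n) n)                      ≡⟨ sym (*-assoc 4 2 (maxν Π (suc n) n)) ⟩
  8 * maxν Π (suc n) n                            ∎)
  where
  open ≤-Reasoning
  n = suc m + suc t

-- Convergence

∣a/c-¾∣ᵘ< : ∀ a c P D → 3 * suc c ≤ a * 4 → (a * 4 ∸ 3 * suc c) * suc D < suc P * (suc c * 4) →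
  ℚᵘ.∣ mkℚᵘ (ℤ.+ a) c ℚᵘ.- mkℚᵘ (ℤ.+ 3) 3 ∣ ℚᵘ.< mkℚᵘ +[1+ P ] D
-- The unnormalised difference a/(c+1) − 3/4 has numerator 4a − 3(c+1) over 4(c+1); the
-- auxiliary identities match the forms in which the definitions of ℚᵘ.- and ℚᵘ.∣_∣ compute them.
∣a/c-¾∣ᵘ< a c P D 3c≤4a excess = *<* (subst₂ ℤ._<_ (sym numerator) (cong ℤ.+_ (sym (denominator c P))) (ℤ.+<+ excess))
  where
  three : ∀ c → suc (c + suc (c + suc (c + 0))) ≡ 3 * suc c
  three = solve-∀
  denominator : ∀ c P → suc (suc (suc (suc (c * 4 + P * suc (suc (suc (suc (c * 4)))))))) ≡ suc P * (suc c * 4)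
  denominator = solve-∀
  numerator : Sign.+ ℤ.◃ (ℤ.∣ (Sign.+ ℤ.◃ (a * 4)) ℤ.+ -[1+ c + suc (c + suc (c + 0)) ] ∣ * suc D) ≡ ℤ.+ ((a * 4 ∸ 3 * suc c) * suc D)
  numerator = begin
    Sign.+ ℤ.◃ (ℤ.∣ (Sign.+ ℤ.◃ (a * 4)) ℤ.+ -[1+ c + suc (c + suc (c + 0)) ] ∣ * suc D)
      ≡⟨ cong (λ z → Sign.+ ℤ.◃ (ℤ.∣ z ℤ.+ -[1+ c + suc (c + suc (c + 0)) ] ∣ * suc D)) (+◃n≡+n (a * 4)) ⟩
    Sign.+ ℤ.◃ (ℤ.∣ (a * 4) ℤ.⊖ suc (c + suc (c + suc (c + 0))) ∣ * suc D)
      ≡⟨ cong (λ z → Sign.+ ℤ.◃ (ℤ.∣ z ∣ * suc D)) (⊖-≥ (subst (_≤ a * 4) (sym (three c)) 3c≤4a)) ⟩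
    Sign.+ ℤ.◃ ((a * 4 ∸ suc (c + suc (c + suc (c + 0)))) * suc D)
      ≡⟨ +◃n≡+n _ ⟩
    ℤ.+ ((a * 4 ∸ suc (c + suc (c + suc (c + 0)))) * suc D)
      ≡⟨ cong (λ z → ℤ.+ ((a * 4 ∸ z) * suc D)) (three c) ⟩
    ℤ.+ ((a * 4 ∸ 3 * suc c) * suc D) ∎
    where open ≡-Reasoning

∣ratio-¾∣< : ∀ a c P D .(cop : Coprime (suc P) (suc D)) → 3 * suc c ≤ a * 4 → (a * 4 ∸ 3 * suc c) * suc D < suc P * (suc c * 4) →
  ℚ.∣ ratio a (suc c) ℚ.- threeQuarters ∣ ℚ.< mkℚ +[1+ P ] D cop
∣ratio-¾∣< a c P D cop 3c≤4a excess = toℚᵘ-cancel-< (ℚᵘP.<-respˡ-≃ (ℚᵘP.≃-sym toℚᵘ-distance) (∣a/c-¾∣ᵘ< a c P D 3c≤4a excess))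
  where
  toℚᵘ-distance : ℚ.toℚᵘ ℚ.∣ ratio a (suc c) ℚ.- threeQuarters ∣ ℚᵘ.≃ ℚᵘ.∣ mkℚᵘ (ℤ.+ a) c ℚᵘ.- mkℚᵘ (ℤ.+ 3) 3 ∣
  toℚᵘ-distance =
    ℚᵘP.≃-trans (toℚᵘ-homo-∣-∣ (ratio a (suc c) ℚ.- threeQuarters)) (ℚᵘP.∣-∣-cong
      (ℚᵘP.≃-trans (toℚᵘ-homo-+ (ratio a (suc c)) (ℚ.- threeQuarters))
        (ℚᵘP.+-cong (toℚᵘ-fromℚᵘ (mkℚᵘ (ℤ.+ a) c))
          (ℚᵘP.≃-trans (toℚᵘ-homo‿- threeQuarters) (ℚᵘP.-‿cong (toℚᵘ-fromℚᵘ (mkℚᵘ (ℤ.+ 3) 3)))))))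

excess-bound : ∀ s a c → 6 * c ≡ (3 + s) * (2 + s) * (1 + s) → 8 * a ≤ (3 + s) * ((3 + s) * (3 + s)) → 3 * c ≤ a * 4 →
  2 * (a * 4 ∸ 3 * c) ≤ (3 + s) * (3 * s + 7)
excess-bound s a c 6c≡ 8a≤ 3c≤4a = +-cancelʳ-≤ (6 * c) _ _ (begin
  2 * (a * 4 ∸ 3 * c) + 6 * c       ≡⟨ double (a * 4 ∸ 3 * c) c ⟩
  2 * (a * 4 ∸ 3 * c + 3 * c)       ≡⟨ cong (2 *_) (m∸n+n≡m 3c≤4a) ⟩
  2 * (a * 4)                       ≡⟨ eight a ⟩
  8 * a                             ≤⟨ 8a≤ ⟩
  (3 + s) * ((3 + s) * (3 + s))     ≡⟨ cube s ⟩
  (3 + s) * (3 * s + 7) + (3 + s) * (2 + s) * (1 + s) ≡⟨ cong ((3 + s) * (3 * s + 7) +_) (sym 6c≡) ⟩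
  (3 + s) * (3 * s + 7) + 6 * c     ∎)
  where
  open ≤-Reasoning
  double : ∀ x c → 2 * x + 6 * c ≡ 2 * (x + 3 * c)
  double = solve-∀
  eight : ∀ a → 2 * (a * 4) ≡ 8 * a
  eight = solve-∀
  cube : ∀ s → (3 + s) * ((3 + s) * (3 + s)) ≡ (3 + s) * (3 * s + 7) + (3 + s) * (2 + s) * (1 + s)
  cube = solve-∀

excess-small : ∀ u r → 3 * u * (3 * (9 * u + r) + 7) < 4 * ((2 + (9 * u + r)) * (1 + (9 * u + r)))
excess-small u r = subst (3 * u * (3 * (9 * u + r) + 7) <_) (sym (expand u r)) (s≤s (m≤m+n _ _))
  where
  expand : ∀ u r → 4 * ((2 + (9 * u + r)) * (1 + (9 * u + r)))
                 ≡ suc (3 * u * (3 * (9 * u + r) + 7) + (243 * u * u + 63 * u * r + 4 * r * r + 87 * u + 12 * r + 7))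
  expand = solve-∀

scaled-excess< : ∀ a c u r P → let s = 9 * u + r in
  6 * c ≡ (3 + s) * (2 + s) * (1 + s) → 8 * a ≤ (3 + s) * ((3 + s) * (3 + s)) → 3 * c ≤ a * 4 →
  (a * 4 ∸ 3 * c) * u < suc P * (c * 4)
scaled-excess< a c u r P 6c≡ 8a≤ 3c≤4a = *-cancelˡ-< 6 _ _ (begin-strict
  6 * (x * u)                             ≡⟨ regroup₁ x u ⟩
  3 * u * (2 * x)                         ≤⟨ *-monoʳ-≤ (3 * u) (excess-bound s a c 6c≡ 8a≤ 3c≤4a) ⟩
  3 * u * ((3 + s) * (3 * s + 7))         ≡⟨ regroup₂ u s ⟩
  (3 + s) * (3 * u * (3 * s + 7))         <⟨ *-monoʳ-< (3 + s) (excess-small u r) ⟩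
  (3 + s) * (4 * ((2 + s) * (1 + s)))     ≡⟨ regroup₃ s ⟩
  4 * ((3 + s) * (2 + s) * (1 + s))       ≡⟨ cong (4 *_) (sym 6c≡) ⟩
  4 * (6 * c)                             ≡⟨ regroup₄ c ⟩
  6 * (c * 4)                             ≤⟨ *-monoʳ-≤ 6 (m≤m+n (c * 4) (P * (c * 4))) ⟩
  6 * (suc P * (c * 4))                   ∎)
  where
  open ≤-Reasoning
  s = 9 * u + r
  x = a * 4 ∸ 3 * c
  regroup₁ : ∀ x u → 6 * (x * u) ≡ 3 * u * (2 * x)
  regroup₁ = solve-∀
  regroup₂ : ∀ u s → 3 * u * ((3 + s) * (3 * s + 7)) ≡ (3 + s) * (3 * u * (3 * s + 7))
  regroup₂ = solve-∀
  regroup₃ : ∀ s → (3 + s) * (4 * ((2 + s) * (1 + s))) ≡ 4 * ((3 + s) * (2 + s) * (1 + s))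
  regroup₃ = solve-∀
  regroup₄ : ∀ c → 4 * (6 * c) ≡ 6 * (c * 4)
  regroup₄ = solve-∀

ratio-near-¾ : ∀ a c r P D .(cop : Coprime (suc P) (suc D)) → let s = 9 * suc D + r in
  6 * c ≡ (3 + s) * (2 + s) * (1 + s) → 8 * a ≤ (3 + s) * ((3 + s) * (3 + s)) → 6 * c ≤ 8 * a →
  ℚ.∣ ratio a c ℚ.- threeQuarters ∣ ℚ.< mkℚ +[1+ P ] D cop
ratio-near-¾ a zero    r P D cop 6c≡ _ _ with () ← 6c≡
ratio-near-¾ a (suc c) r P D cop 6c≡ 8a≤ 6c≤8a = ∣ratio-¾∣< a c P D cop 3c≤4a (scaled-excess< a (suc c) (suc D) r P 6c≡ 8a≤ 3c≤4a)
  where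
  eight : ∀ a → 8 * a ≡ 2 * (a * 4)
  eight = solve-∀
  3c≤4a : 3 * suc c ≤ a * 4
  3c≤4a = *-cancelˡ-≤ 2 (subst₂ _≤_ (*-assoc 2 3 (suc c)) (eight a) 6c≤8a)

-- With n = 3 + s, the bounds give 0 ≤ 8 A − 6 C(n,3) ≤ n (3s + 7) while 6 C(n,3) = n (n − 1) (n − 2),
-- so |A / C(n,3) − 3/4| = O(1/n); the threshold n ≥ 3 + 9 (D + 1) brings it below (P + 1)/(D + 1).
squeeze-¾ : (A : ℕ → ℕ) → (∀ n → 8 * A n ≤ n * (n * n)) → (∀ s → 6 * ((3 + s) C 3) ≤ 8 * A (3 + s)) →
  Converges (λ n → ratio (A n) (n C 3)) threeQuarters
squeeze-¾ A upper lower (mkℚ +[1+ P ] D cop) _ = 3 + 9 * suc D , λ n N≤n →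
  subst (λ n → ℚ.∣ ratio (A n) (n C 3) ℚ.- threeQuarters ∣ ℚ.< mkℚ +[1+ P ] D cop) (m+[n∸m]≡n N≤n) (close (n ∸ (3 + 9 * suc D)))
  where
  close : ∀ r → let n = 3 + (9 * suc D + r) in ℚ.∣ ratio (A n) (n C 3) ℚ.- threeQuarters ∣ ℚ.< mkℚ +[1+ P ] D cop
  close r = ratio-near-¾ (A (3 + s)) ((3 + s) C 3) r P D cop (6*C3 (suc s)) (upper (3 + s)) (lower s)
    where s = 9 * suc D + r
squeeze-¾ A upper lower (mkℚ (ℤ.+ 0)   _ _) 0<ε with () ← ℚ.positive 0<ε
squeeze-¾ A upper lower (mkℚ -[1+ _ ] _ _) 0<ε with () ← ℚ.positive 0<ε

eventually-constant⇒converges : ∀ (f : ℕ → ℚ) N → (∀ k → N ≤ k → f k ≡ f N) → Converges f (f N)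
eventually-constant⇒converges f N const ε 0<ε = N , λ k N≤k →
  subst (λ x → ℚ.∣ x ℚ.- f N ∣ ℚ.< ε) (sym (const k N≤k)) (subst (ℚ._< ε) (sym (cong ℚ.∣_∣ (+-inverseʳ (f N)))) 0<ε)

packingDensity-¾ : ∀ Π → (∀ n → 8 * maxν Π (suc n) n ≤ n * (n * n)) → (∀ s → 6 * ((3 + s) C 3) ≤ 8 * maxν Π (4 + s) (3 + s)) →
  PackingDensity Π threeQuarters
packingDensity-¾ Π upper lower =
  (λ n → δ Π (suc n) n) ,
  (λ n → eventually-constant⇒converges (λ k → δ Π k n) (suc n) (λ k k>n → cong (λ x → ratio x (n C 3)) (maxν-stable Π k n k>n))) ,
  squeeze-¾ (λ n → maxν Π (suc n) n) upper lower

isEQ isGT : Cmp → Bool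
isEQ c = eqCmp c EQ
isGT c = eqCmp c GT

proposition3p3 : PackingDensity (p112 ∷ p122 ∷ []) threeQuarters
               × PackingDensity (p213 ∷ p132 ∷ []) threeQuarters
proposition3p3 =
  packingDensity-¾ Π₁ (8maxν≤n³ Π₁ isEQ (bichromatic-by-evaluation Π₁ isEQ tt))
                      (6C≤8maxν Π₁ EQ (refl , refl , refl) (λ m _ → flatWord m) flatWord-twoBlock flatWord-≤) ,
  packingDensity-¾ Π₂ (8maxν≤n³ Π₂ isGT (bichromatic-by-evaluation Π₂ isGT tt))
                      (6C≤8maxν Π₂ GT (refl , refl , refl) layeredWord layeredWord-twoBlock layeredWord-≤)
  where
  Π₁ Π₂ : List (Vec ℕ 3)
  Π₁ = p112 ∷ p122 ∷ []
  Π₂ = p213 ∷ p132 ∷ []
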